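{- Let $N\ge 5$ be an integer. The supremum $\sup_{E\in\mathcal{T}^N_3}P^N_s(E)$ is realised by the trunk graph whose associated sequence is $$\left(1,1,\left\lfloor \tfrac N3\right\rfloor-1\right)\ \text{ if } N\equiv 0 \pmod 3,\qquad \left(1,3,\left\lfloor \tfrac N3\right\rfloor-2\right)\ \text{ if } N\equiv 1\pmod 3,\qquad \left(1,2,\left\lfloor \tfrac N3\right\rfloor-1\right)\ \text{ if } N\equiv 2\pmod 3.$$
   Context: A trunk graph with $N$ edges is a directed graph with vertices $v_1,\dots,v_n$ ($n\ge2$) such that every edge goes from some $v_i$ to $v_{i+1}$, there are $m_i\ge1$ edges from $v_i$ to $v_{i+1}$ for each $1\le i\le n-1$, and $m_1+\dots+m_{n-1}=N$. It is written $(m_1,\dots,m_{n-1})$. $\mathcal{T}^N_3$ is the set of trunk graphs with $N$ edges and all $m_i\le 3$. A trunk graph has associated sequence $(n_1,n_2,n_3)$ (with $n_1,n_2,n_3\ge0$) if $(m_1,\dots,m_{n-1})$ consists of $n_1$ ones, followed by $n_2$ twos, followed by $n_3$ threes. $P^N_s(E)$ is the number of finite directed paths in $E$ (including the path of length $0$) ending at the unique sink $v_n$. -}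

module Defs where

open import Data.Fin using (Fin; zero; suc; inject₁; fromℕ)
open import Data.Fin.Properties using (+↔⊎; *↔×)
open import Data.List using (List; []; _∷_; _++_; length; lookup; replicate)
open import Data.List.Relation.Unary.All using (All)
open import Data.Nat using (ℕ; suc; _+_; _*_; _≤_; _≥_)
open import Data.Nat.ListAction using (sum)
open import Data.Product using (∃-syntax; Σ-syntax; _×_; _,_; proj₁)
open import Data.Product.Function.NonDependent.Propositional using (_×-↔_)
open import Data.Sum using (_⊎_; inj₁; inj₂)
open import Data.Sum.Function.Propositional using (_⊎-↔_)
open import Function.Bundles using (_↔_; mk↔ₛ′)
open import Function.Properties.Inverse using (↔-refl; ↔-sym; ↔-trans)
open import Relation.Binary.Construct.Closure.ReflexiveTransitive using (Star; ε; _◅_; gmap)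
open import Relation.Binary.PropositionalEquality using (_≡_; refl; sym; cong; subst; subst₂)
open import Relation.Nullary using (¬_; contradiction)

-- With ms = (m₁, …, mₙ₋₁), the vertices v₁, …, vₙ are the elements of
-- Fin n in order, so that inject₁ i and suc i are consecutive vertices.

Vertex : List ℕ → Set
Vertex ms = Fin (suc (length ms))

data Edge (ms : List ℕ) : Vertex ms → Vertex ms → Set where
  edge : (i : Fin (length ms)) → Fin (lookup ms i) → Edge ms (inject₁ i) (suc i)

sink : (ms : List ℕ) → Vertex ms
sink ms = fromℕ (length ms)

-- Star (Edge ms) u v is the type of directed paths from u to v: parallel
-- edges give different paths, and ε is the path of length 0.

PathToSink : List ℕ → Set
PathToSink ms = Σ[ u ∈ Vertex ms ] Star (Edge ms) u (sink ms)

record TrunkGraph (N : ℕ) : Set where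
  field
    multiplicities : List ℕ
    n≥2            : suc (length multiplicities) ≥ 2
    positive       : All (_≥ 1) multiplicities
    total          : sum multiplicities ≡ N

open TrunkGraph public

record 𝒯₃ (N : ℕ) : Set where
  field
    graph   : TrunkGraph N
    bounded : All (_≤ 3) (multiplicities graph)

open 𝒯₃ public

HasAssociatedSequence : ∀ {N} → TrunkGraph N → ℕ → ℕ → ℕ → Set
HasAssociatedSequence E n₁ n₂ n₃ =
  multiplicities E ≡ replicate n₁ 1 ++ replicate n₂ 2 ++ replicate n₃ 3

-- Finiteness of PathToSink: in the graph (m, ms), paths avoiding the first
-- vertex are paths of the graph ms, and a path leaving the first vertex is
-- one of m edges followed by a path of ms from its first vertex.

private
  variable
    m  : ℕ
    ms : List ℕ

up : ∀ {u v} → Star (Edge ms) u v → Star (Edge (m ∷ ms)) (suc u) (suc v)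
up = gmap suc λ { (edge i l) → edge (suc i) l }

down : ∀ {x y u v} → Star (Edge (m ∷ ms)) x y → x ≡ suc u → y ≡ suc v →
       Star (Edge ms) u v
down ε                    refl refl = ε
down (edge zero l ◅ p)    ()   f
down (edge (suc i) l ◅ p) refl f    = edge i l ◅ down p refl f

down-up : ∀ {u v} (p : Star (Edge ms) u v) → down {m} (up p) refl refl ≡ p
down-up ε              = refl
down-up (edge i l ◅ p) = cong (edge i l ◅_) (down-up p)

up-down : ∀ {x y u v} (p : Star (Edge (m ∷ ms)) x y) (e : x ≡ suc u) (f : y ≡ suc v) →
          up (down p e f) ≡ subst₂ (Star (Edge (m ∷ ms))) e f p
up-down ε                    refl refl = refl
up-down (edge zero l ◅ p)    ()   f
up-down (edge (suc i) l ◅ p) refl refl = cong (edge (suc i) l ◅_) (up-down p refl refl)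

first : ∀ {v} → Fin m × Star (Edge ms) zero v → Star (Edge (m ∷ ms)) zero (suc v)
first (l , p) = edge zero l ◅ up p

unfirst : ∀ {x y v} → Star (Edge (m ∷ ms)) x y → x ≡ zero → y ≡ suc v →
          Fin m × Star (Edge ms) zero v
unfirst ε                    refl ()
unfirst (edge zero l ◅ p)    e    f = l , down p refl f
unfirst (edge (suc i) l ◅ p) ()   f

first-unfirst : ∀ {x y v} (p : Star (Edge (m ∷ ms)) x y) (e : x ≡ zero) (f : y ≡ suc v) →
                first (unfirst p e f) ≡ subst₂ (Star (Edge (m ∷ ms))) e f p
first-unfirst ε                    refl ()
first-unfirst (edge zero l ◅ p)    refl refl = cong (edge zero l ◅_) (up-down p refl refl)
first-unfirst (edge (suc i) l ◅ p) ()   f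

first↔ : ∀ {v} → Star (Edge (m ∷ ms)) zero (suc v) ↔ (Fin m × Star (Edge ms) zero v)
first↔ = mk↔ₛ′ (λ p → unfirst p refl refl) first
  (λ { (l , p) → cong (l ,_) (down-up p) })
  (λ p → first-unfirst p refl refl)

split↔ : PathToSink (m ∷ ms) ↔
         (Star (Edge (m ∷ ms)) zero (sink (m ∷ ms)) ⊎ PathToSink ms)
split↔ = mk↔ₛ′
  (λ { (zero , p) → inj₁ p ; (suc u , p) → inj₂ (u , down p refl refl) })
  (λ { (inj₁ p) → zero , p ; (inj₂ (u , p)) → suc u , up p })
  (λ { (inj₁ p) → refl ; (inj₂ (u , p)) → cong (λ q → inj₂ (u , q)) (down-up p) })
  (λ { (zero , p) → refl ; (suc u , p) → cong (suc u ,_) (up-down p refl refl) })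

noEdge : ∀ {u v} → ¬ Edge [] u v
noEdge (edge () l)

trivial : ∀ {u} (p : Star (Edge []) zero u) (e : u ≡ zero) →
          subst (Star (Edge []) zero) e p ≡ ε
trivial ε       refl = refl
trivial (a ◅ p) e    = contradiction a noEdge

fromFirst-finite : ∀ ms → ∃[ k ] (Star (Edge ms) zero (sink ms) ↔ Fin k)
fromFirst-finite [] =
  1 , mk↔ₛ′ (λ _ → zero) (λ _ → ε) (λ { zero → refl ; (suc ()) }) (λ p → sym (trivial p refl))
fromFirst-finite (m ∷ ms) =
  let k , paths↔ = fromFirst-finite ms
  in  m * k , ↔-trans first↔ (↔-trans (↔-refl ×-↔ paths↔) (↔-sym *↔×))

pathToSink-finite : ∀ ms → ∃[ k ] (PathToSink ms ↔ Fin k)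
pathToSink-finite [] =
  1 , mk↔ₛ′ (λ _ → zero) (λ _ → zero , ε) (λ { zero → refl ; (suc ()) })
        (λ { (zero , p) → cong (zero ,_) (sym (trivial p refl)) ; (suc () , p) })
pathToSink-finite (m ∷ ms) =
  let j , first-paths↔ = fromFirst-finite (m ∷ ms)
      k , later-paths↔ = pathToSink-finite ms
  in  j + k , ↔-trans split↔ (↔-trans (first-paths↔ ⊎-↔ later-paths↔) (↔-sym +↔⊎))

Pₛ : ∀ {N} → TrunkGraph N → ℕ
Pₛ E = proj₁ (pathToSink-finite (multiplicities E))

IsSupremum : {I : Set} → (I → ℕ) → ℕ → Set
IsSupremum f s = (∀ i → f i ≤ s) × (∀ b → (∀ i → f i ≤ b) → s ≤ b)

-- The multiplicities, and hence the graph, are determined by the associated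
-- sequence, so existence expresses that "the" graph with that sequence works.

SupremumRealisedBy : ℕ → ℕ → ℕ → ℕ → Set
SupremumRealisedBy N n₁ n₂ n₃ =
  Σ[ E ∈ 𝒯₃ N ] (HasAssociatedSequence (graph E) n₁ n₂ n₃
               × IsSupremum {𝒯₃ N} (λ F → Pₛ (graph F)) (Pₛ (graph E)))

{-# OPTIONS --safe #-}
module Submission where

-- Reading a graph from its source to its sink, P satisfies Horner's rule
-- P (ms , m) = 1 + m * P ms: a path to the new sink is either trivial or a
-- path to the old sink followed by one of m edges.  Hence P is a left fold of
-- the map a ↦ 1 + m * a over the multiplicities (paths≡horner), and the
-- largest value f N over multiplicities at most 3 with sum N obeys the
-- recursion f N = max over m of 1 + m * f (N - m).
--
-- This recursion is solved by optimum: it starts 1, 2, 3, 5, 7, 11, 16, 23 and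
-- then continues by optimum (N + 3) = 1 + 3 * optimum N for N at least 5, that
-- is, from total 8 on the last multiplicity may be taken to be 3.  That no other choice is
-- better, namely 1 + m * optimum n ≤ optimum (n + m) for m ≤ 3, is a finite
-- check for n < 8, and passes from n to n + 3 because m ≤ 3 (horner-step).
-- Folding this inequality along the list bounds every P (horner≤optimum).
--
-- The bound is attained by (1,2,2), (1,2,3) and (1,2,2,2), of totals 5, 6 and
-- 7, and appending a 3 to a graph that attains it with total at least 5 gives
-- another one.  These are exactly the graphs with the stated associated
-- sequences.

open import Data.Nat using (ℕ; suc; _≥_; _/_; _%_; _∸_; _+_; _*_; _≤_; z≤n; s≤s; _≤?_; _<?_)
open import Data.Nat.DivMod using (m≡m%n+[m/n]*n)
open import Data.Nat.ListAction using (sum)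
open import Data.Nat.ListAction.Properties using (sum-++)
open import Data.Nat.Properties
  using (allUpTo?; ≤-refl; ≤-reflexive; ≤-trans; +-assoc; +-comm; +-identityʳ; *-comm;
         +-monoˡ-≤; *-monoʳ-≤; module ≤-Reasoning)
open import Data.Nat.Tactic.RingSolver using (solve-∀)
open import Data.List using (List; []; _∷_; _++_; foldl; replicate)
open import Data.List.Properties using (foldl-++)
open import Data.List.Relation.Unary.All using (All; []; _∷_; all?)
open import Data.List.Relation.Unary.All.Properties using (++⁺; replicate⁺)
open import Data.Product using (_×_; _,_; proj₁)
open import Relation.Binary.PropositionalEquality
  using (_≡_; refl; sym; trans; cong; cong₂; subst; module ≡-Reasoning)
open import Relation.Nullary.Decidable using (True; toWitness; from-yes)
open import Defs

-- The number of paths to the sink of the graph with the given multiplicities.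
paths : List ℕ → ℕ
paths ms = proj₁ (pathToSink-finite ms)

-- The number of paths from the first vertex to the sink.
fullPaths : List ℕ → ℕ
fullPaths ms = proj₁ (fromFirst-finite ms)

-- If a paths end at the first vertex of ms, then horner a ms paths end at the
-- sink.
horner : ℕ → List ℕ → ℕ
horner = foldl (λ a m → 1 + m * a)

-- Of the 1 + c paths ending at the first vertex, the trivial one is already
-- counted in paths ms.
paths-horner : ∀ c ms → fullPaths ms * c + paths ms ≡ horner (1 + c) ms
paths-horner c [] = trans (cong (_+ 1) (+-identityʳ c)) (+-comm c 1)
paths-horner c (m ∷ ms) = begin
  m * fullPaths ms * c + (m * fullPaths ms + paths ms)
    ≡⟨ regroup m (fullPaths ms) c (paths ms) ⟩
  fullPaths ms * (m * (1 + c)) + paths ms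
    ≡⟨ paths-horner (m * (1 + c)) ms ⟩
  horner (1 + m * (1 + c)) ms ∎
  where
  open ≡-Reasoning
  regroup : ∀ m w c p → m * w * c + (m * w + p) ≡ w * (m * (1 + c)) + p
  regroup = solve-∀

paths≡horner : ∀ ms → paths ms ≡ horner 1 ms
paths≡horner ms = trans (cong (_+ paths ms) (sym (*-comm (fullPaths ms) 0))) (paths-horner 0 ms)

-- The largest number of paths to the sink over all lists of multiplicities at
-- most 3 with sum N.  The empty list counts here, so the value at 0 is 1.
optimum : ℕ → ℕ
optimum 0 = 1
optimum 1 = 2
optimum 2 = 3
optimum 3 = 5
optimum 4 = 7
optimum 5 = 11
optimum 6 = 16
optimum 7 = 23
optimum (suc (suc (suc (suc (suc (suc (suc (suc n)))))))) =
  1 + 3 * optimum (suc (suc (suc (suc (suc n)))))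

horner-step-small : ∀ {m} n {n<8 : True (n <? 8)} → m ≤ 3 → 1 + m * optimum n ≤ optimum (n + m)
horner-step-small n {n<8} m≤3 =
  from-yes (allUpTo? (λ n → allUpTo? (λ m → 1 + m * optimum n ≤? optimum (n + m)) 4) 8)
    (toWitness n<8) (s≤s m≤3)

horner-step : ∀ {m} n → m ≤ 3 → 1 + m * optimum n ≤ optimum (n + m)
horner-step 0 = horner-step-small 0
horner-step 1 = horner-step-small 1
horner-step 2 = horner-step-small 2
horner-step 3 = horner-step-small 3
horner-step 4 = horner-step-small 4
horner-step 5 = horner-step-small 5
horner-step 6 = horner-step-small 6
horner-step 7 = horner-step-small 7
horner-step {m} (suc (suc (suc (suc (suc (suc (suc (suc n)))))))) m≤3 = begin
  1 + m * (1 + 3 * x)   ≡⟨ expand m x ⟩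
  m + (1 + 3 * (m * x)) ≤⟨ +-monoˡ-≤ (1 + 3 * (m * x)) m≤3 ⟩
  3 + (1 + 3 * (m * x)) ≡⟨ collect (m * x) ⟩
  1 + 3 * (1 + m * x)   ≤⟨ s≤s (*-monoʳ-≤ 3 (horner-step (suc (suc (suc (suc (suc n))))) m≤3)) ⟩
  1 + 3 * optimum (5 + n + m) ∎
  where
  open ≤-Reasoning
  x = optimum (5 + n)
  expand : ∀ m x → 1 + m * (1 + 3 * x) ≡ m + (1 + 3 * (m * x))
  expand = solve-∀
  collect : ∀ y → 3 + (1 + 3 * y) ≡ 1 + 3 * (1 + y)
  collect = solve-∀

horner≤optimum : ∀ {a} n {ms} → All (_≤ 3) ms → a ≤ optimum n → horner a ms ≤ optimum (n + sum ms)
horner≤optimum {a} n [] a≤ = subst (λ k → a ≤ optimum k) (sym (+-identityʳ n)) a≤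
horner≤optimum {a} n {m ∷ ms} (m≤3 ∷ ms≤3) a≤ =
  subst (λ k → horner a (m ∷ ms) ≤ optimum k) (+-assoc n m (sum ms))
    (horner≤optimum (n + m) ms≤3 (≤-trans (s≤s (*-monoʳ-≤ m a≤)) (horner-step n m≤3)))

Pₛ≤optimum : ∀ {N} (F : 𝒯₃ N) → Pₛ (graph F) ≤ optimum N
Pₛ≤optimum {N} F = begin
  paths ms         ≡⟨ paths≡horner ms ⟩
  horner 1 ms      ≤⟨ horner≤optimum 0 (bounded F) ≤-refl ⟩
  optimum (sum ms) ≡⟨ cong optimum (total (graph F)) ⟩
  optimum N        ∎
  where
  open ≤-Reasoning
  ms = multiplicities (graph F)

horner-threes : ∀ n k → horner (optimum (5 + n)) (replicate k 3) ≡ optimum (5 + n + k * 3)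
horner-threes n 0 = cong optimum (sym (+-identityʳ (5 + n)))
horner-threes n (suc k) = trans (horner-threes (3 + n) k) (cong optimum (shift n (k * 3)))
  where
  shift : ∀ n j → 5 + (3 + n) + j ≡ 5 + n + (3 + j)
  shift = solve-∀

sum-replicate : ∀ k m → sum (replicate k m) ≡ k * m
sum-replicate 0 m       = refl
sum-replicate (suc k) m = cong (m +_) (sum-replicate k m)

attained⇒supremum : ∀ {N} (E : 𝒯₃ N) → Pₛ (graph E) ≡ optimum N →
                    IsSupremum {𝒯₃ N} (λ F → Pₛ (graph F)) (Pₛ (graph E))
attained⇒supremum E eq =
  (λ F → ≤-trans (Pₛ≤optimum F) (≤-reflexive (sym eq))) , (λ b bound → bound E)

-- An optimal graph stays optimal when threes are appended, provided that its
-- total 5 + n is at least 5.  The seed may itself end in threes, so n₃ need not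
-- be the number k of appended ones.
supremum-append-threes :
  ∀ {N} m ms n k n₁ n₂ n₃ → let seed = m ∷ ms in
  {seed≥1 : True (all? (1 ≤?_) seed)} {seed≤3 : True (all? (_≤? 3) seed)} →
  sum seed ≡ 5 + n → horner 1 seed ≡ optimum (5 + n) →
  N ≡ 5 + n + k * 3 →
  seed ++ replicate k 3 ≡ replicate n₁ 1 ++ replicate n₂ 2 ++ replicate n₃ 3 →
  SupremumRealisedBy N n₁ n₂ n₃
supremum-append-threes m ms n k n₁ n₂ n₃ {seed≥1} {seed≤3}
                       seed-sum seed-optimal refl assoc-seq =
  E , assoc-seq , attained⇒supremum E optimal
  where
  open ≡-Reasoning
  seed = m ∷ ms
  E : 𝒯₃ (5 + n + k * 3)
  E = record
    { graph = record
      { multiplicities = seed ++ replicate k 3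
      ; n≥2            = s≤s (s≤s z≤n)
      ; positive       = ++⁺ (toWitness seed≥1) (replicate⁺ k (from-yes (1 ≤? 3)))
      ; total          = trans (sum-++ seed (replicate k 3))
                               (cong₂ _+_ seed-sum (sum-replicate k 3))
      }
    ; bounded = ++⁺ (toWitness seed≤3) (replicate⁺ k ≤-refl)
    }
  optimal : paths (seed ++ replicate k 3) ≡ optimum (5 + n + k * 3)
  optimal = begin
    paths (seed ++ replicate k 3)             ≡⟨ paths≡horner (seed ++ replicate k 3) ⟩
    horner 1 (seed ++ replicate k 3)          ≡⟨ foldl-++ _ 1 seed (replicate k 3) ⟩
    horner (horner 1 seed) (replicate k 3)    ≡⟨ cong (λ a → horner a (replicate k 3)) seed-optimal ⟩
    horner (optimum (5 + n)) (replicate k 3)  ≡⟨ horner-threes n k ⟩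
    optimum (5 + n + k * 3)                   ∎

≡0-case : ∀ {N} q → N ≥ 5 → N ≡ q * 3 → SupremumRealisedBy N 1 1 (q ∸ 1)
≡0-case 0 () refl
≡0-case 1 (s≤s (s≤s (s≤s ()))) refl
≡0-case (suc (suc k)) _ N≡ =
  supremum-append-threes 1 (2 ∷ 3 ∷ []) 1 k 1 1 (suc k) refl refl N≡ refl

≡1-case : ∀ {N} q → N ≥ 5 → N ≡ 1 + q * 3 → SupremumRealisedBy N 1 3 (q ∸ 2)
≡1-case 0 (s≤s ()) refl
≡1-case 1 (s≤s (s≤s (s≤s (s≤s ())))) refl
≡1-case (suc (suc k)) _ N≡ =
  supremum-append-threes 1 (2 ∷ 2 ∷ 2 ∷ []) 2 k 1 3 k refl refl N≡ refl

≡2-case : ∀ {N} q → N ≥ 5 → N ≡ 2 + q * 3 → SupremumRealisedBy N 1 2 (q ∸ 1)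
≡2-case 0 (s≤s (s≤s ())) refl
≡2-case (suc k) _ N≡ =
  supremum-append-threes 1 (2 ∷ 2 ∷ []) 0 k 1 2 k refl refl N≡ refl

theorem4p11 : (N : ℕ) → N ≥ 5 →
    (N % 3 ≡ 0 → SupremumRealisedBy N 1 1 (N / 3 ∸ 1))
    × (N % 3 ≡ 1 → SupremumRealisedBy N 1 3 (N / 3 ∸ 2))
    × (N % 3 ≡ 2 → SupremumRealisedBy N 1 2 (N / 3 ∸ 1))
theorem4p11 N N≥5 =
    (λ eq → ≡0-case (N / 3) N≥5 (division eq))
  , (λ eq → ≡1-case (N / 3) N≥5 (division eq))
  , (λ eq → ≡2-case (N / 3) N≥5 (division eq))
  where
  division : ∀ {r} → N % 3 ≡ r → N ≡ r + N / 3 * 3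
  division eq = trans (m≡m%n+[m/n]*n N 3) (cong (_+ N / 3 * 3) eq)
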